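{- Fix $m\ge1$ and $n\ge0$. For every formula $\phi\in\mathcal{L}^m$ and every label $x$: if $\phi$ is valid (true at every world of every $\mathsf{Ldm}_{n}^{m}$-model), then the sequent $x:\phi$ is derivable in the calculus $\mathsf{Ldm}_{n}^{m}\mathsf{L}$ (which contains no cut rule).
   Context: Language. $Ag=\{1,\dots,m\}$, $Var$ a countable set of propositional variables; formulas of $\mathcal{L}^m$: $\phi ::= p \mid \overline{p} \mid (\phi\wedge\phi) \mid (\phi\vee\phi) \mid \Box\phi \mid \Diamond\phi \mid [i]\phi \mid \langle i\rangle\phi$. Models. An $\mathsf{Ldm}_{n}^{m}$-frame is $(W,\{\mathcal{R}_i\}_{i\in Ag})$ with $W\neq\emptyset$ and: (C1) each $\mathcal{R}_i\subseteq W\times W$ is an equivalence relation; (C2) for all $u_1,\dots,u_m\in W$, $\bigcap_{i\in Ag}\mathcal{R}_i(u_i)\neq\emptyset$, where $\mathcal{R}_i(w)=\{v:(w,v)\in\mathcal{R}_i\}$; (C3) only if $n>0$: for each $i\in Ag$ and all $w_0,\dots,w_n\in W$ there are $0\le k<j\le n$ with $(w_k,w_j)\in\mathcal{R}_i$. A model adds a valuation $V:Var\to\mathcal{P}(W)$. Satisfaction: $w\Vdash p$ iff $w\in V(p)$; $w\Vdash\overline{p}$ iff $w\notin V(p)$; $\wedge,\vee$ as usual; $w\Vdash\Box\phi$ iff $u\Vdash\phi$ for all $u\in W$; $w\Vdash\Diamond\phi$ iff $u\Vdash\phi$ for some $u\in W$; $w\Vdash[i]\phi$ iff $u\Vdash\phi$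 for all $u\in\mathcal{R}_i(w)$; $w\Vdash\langle i\rangle\phi$ iff $u\Vdash\phi$ for some $u\in\mathcal{R}_i(w)$. Labelled sequents $\mathcal{R},\Gamma$: $\mathcal{R}$ a multiset of relational atoms $\mathcal{R}_ixy$, $\Gamma$ a multiset of labelled formulas $x:\phi$. Derivations are finite trees whose leaves are $(\mathsf{id})$ instances. Rules of $\mathsf{Ldm}_{n}^{m}\mathsf{L}$ (premise(s) / conclusion): $(\mathsf{id})$: / $\mathcal{R}, w:p, w:\overline{p},\Gamma$. $(\wedge)$: $\mathcal{R}, w:\phi\wedge\psi, w:\phi,\Gamma$ and $\mathcal{R}, w:\phi\wedge\psi, w:\psi,\Gamma$ / $\mathcal{R}, w:\phi\wedge\psi,\Gamma$. $(\vee)$: $\mathcal{R}, w:\phi\vee\psi, w:\phi, w:\psi,\Gamma$ / $\mathcal{R}, w:\phi\vee\psi,\Gamma$. $(\Box)$: $\mathcal{R}, w:\Box\phi, v:\phi,\Gamma$ / $\mathcal{R}, w:\Box\phi,\Gamma$ ($v$ fresh). $(\Diamond)$: $\mathcal{R}, w:\Diamond\phi, u:\phi,\Gamma$ / $\mathcal{R}, w:\Diamond\phi,\Gamma$. $(\mathsf{IOA})$: $\mathcal{R},\mathcal{R}_1u_1v,\dots,\mathcal{R}_mu_mv,\Gamma$ / $\mathcal{R},\Gamma$ ($v$ fresh). $([i])$: $\mathcal{R},\mathcal{R}_iwv, w:[i]\phi, v:\phi,\Gamma$ / $\mathcal{R}, w:[i]\phi,\Gamma$ ($v$ fresh). $(\mathsf{Pr}_i)$: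 $\mathcal{R}, w:\langle i\rangle\phi, u:\phi,\Gamma$ / $\mathcal{R}, w:\langle i\rangle\phi,\Gamma$, applicable only if $w=u$ or there are labels $w=z_0,\dots,z_k=u$ ($k\ge1$) with $\mathcal{R}_iz_lz_{l+1}\in\mathcal{R}$ or $\mathcal{R}_iz_{l+1}z_l\in\mathcal{R}$ for each $l<k$. $(\mathsf{APC}^i_n)$ (only if $n>0$): premises $\mathcal{R},\mathcal{R}_iw_kw_j,\Gamma$ for all $0\le k\le n-1$, $k+1\le j\le n$ / $\mathcal{R},\Gamma$. "Fresh" means not occurring in the conclusion. One copy of $([i])$, $(\mathsf{Pr}_i)$, $(\mathsf{APC}^i_n)$ for each $i\in Ag$. -}

module Defs where

open import Data.Nat using (ℕ; suc; _<_)
open import Data.Fin as Fin using (Fin)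
open import Data.List using (List; []; _∷_; _++_; map; concatMap; tabulate)
open import Data.List.Membership.Propositional using (_∈_; _∉_)
open import Data.Product using (∃; ∃₂; _×_)
open import Data.Sum using (_⊎_)
open import Level using (0ℓ)
open import Relation.Binary.Core using (Rel)
open import Relation.Binary.Structures using (IsEquivalence)
open import Relation.Binary.Construct.Closure.Equivalence using (EqClosure)
open import Relation.Nullary using (¬_; Dec)

Var : Set
Var = ℕ

-- Agents are 0, …, m - 1 rather than 1, …, m.
Ag : ℕ → Set
Ag m = Fin m

infixr 30 □_ ◇_ [_]_ ⟨_⟩_
infixr 25 _∧_
infixr 24 _∨_

-- Formulas are in negation normal form; natom p is the literal p̄.
data Formula (m : ℕ) : Set where
  atom  : Var → Formula m
  natom : Var → Formula m
  _∧_   : Formula m → Formula m → Formula m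
  _∨_   : Formula m → Formula m → Formula m
  □_    : Formula m → Formula m
  ◇_    : Formula m → Formula m
  [_]_  : Ag m → Formula m → Formula m
  ⟨_⟩_  : Ag m → Formula m → Formula m

record Frame (m n : ℕ) : Set₁ where
  field
    W             : Set
    inhabited     : W
    R             : Ag m → Rel W 0ℓ
    isEquivalence : ∀ i → IsEquivalence (R i)
    independence  : (u : Ag m → W) → ∃ λ v → ∀ i → R i (u i) v
    limitedChoice : 0 < n → ∀ i (w : Fin (suc n) → W) →
                    ∃₂ λ (k j : Fin (suc n)) → k Fin.< j × R i (w k) (w j)

record Model (m n : ℕ) : Set₁ where
  field
    frame : Frame m n
  open Frame frame public
  field
    V : Var → W → Set

infix 4 _,_⊩_

_,_⊩_ : ∀ {m n} (M : Model m n) → Model.W M → Formula m → Set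
M , w ⊩ atom p    = Model.V M p w
M , w ⊩ natom p   = ¬ Model.V M p w
M , w ⊩ (φ ∧ ψ)   = (M , w ⊩ φ) × (M , w ⊩ ψ)
M , w ⊩ (φ ∨ ψ)   = (M , w ⊩ φ) ⊎ (M , w ⊩ ψ)
M , w ⊩ (□ φ)     = ∀ u → M , u ⊩ φ
M , w ⊩ (◇ φ)     = ∃ λ u → M , u ⊩ φ
M , w ⊩ ([ i ] φ) = ∀ u → Model.R M i w u → M , u ⊩ φ
M , w ⊩ (⟨ i ⟩ φ) = ∃ λ u → Model.R M i w u × (M , u ⊩ φ)

-- The logic is classical: every formula is true or not true at every world.
-- Excluded middle makes every model bivalent; without it, p ∨ p̄ could not be
-- shown valid if validity ranged over all models.
Bivalent : ∀ {m n} → Model m n → Set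
Bivalent M = ∀ w ψ → Dec (M , w ⊩ ψ)

Valid : ∀ {m} → ℕ → Formula m → Set₁
Valid {m} n φ = (M : Model m n) → Bivalent M → ∀ w → M , w ⊩ φ

Label : Set
Label = ℕ

record RelAtom (m : ℕ) : Set where
  constructor rel
  field
    agent  : Ag m
    source : Label
    target : Label

infix 5 _∶_

record LFormula (m : ℕ) : Set where
  constructor _∶_
  field
    label   : Label
    formula : Formula m

labels : ∀ {m} → List (RelAtom m) → List (LFormula m) → List Label
labels 𝓡 Γ = concatMap (λ a → RelAtom.source a ∷ RelAtom.target a ∷ []) 𝓡
             ++ map LFormula.label Γ

Fresh : ∀ {m} → Label → List (RelAtom m) → List (LFormula m) → Set
Fresh v 𝓡 Γ = v ∉ labels 𝓡 Γ

-- w = u, or an undirected 𝓡ᵢ-path in 𝓡 leads from w to u.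
Path : ∀ {m} → List (RelAtom m) → Ag m → Label → Label → Set
Path 𝓡 i = EqClosure (λ x y → rel i x y ∈ 𝓡)

-- Derivable n 𝓡 Γ : the sequent 𝓡 , Γ has a derivation.
-- The two multisets are represented by lists.  Every premise contains its whole
-- conclusion, so "the conclusion has the form …, w : φ, Γ" is list membership,
-- a premise is obtained by consing, and the order of entries is immaterial.
data Derivable {m : ℕ} (n : ℕ) (𝓡 : List (RelAtom m)) (Γ : List (LFormula m)) : Set where

  idR  : ∀ {w p} → (w ∶ atom p) ∈ Γ → (w ∶ natom p) ∈ Γ →
         Derivable n 𝓡 Γ

  ∧R   : ∀ {w φ ψ} → (w ∶ φ ∧ ψ) ∈ Γ →
         Derivable n 𝓡 ((w ∶ φ) ∷ Γ) →
         Derivable n 𝓡 ((w ∶ ψ) ∷ Γ) →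
         Derivable n 𝓡 Γ

  ∨R   : ∀ {w φ ψ} → (w ∶ φ ∨ ψ) ∈ Γ →
         Derivable n 𝓡 ((w ∶ φ) ∷ (w ∶ ψ) ∷ Γ) →
         Derivable n 𝓡 Γ

  □R   : ∀ {w φ v} → (w ∶ □ φ) ∈ Γ → Fresh v 𝓡 Γ →
         Derivable n 𝓡 ((v ∶ φ) ∷ Γ) →
         Derivable n 𝓡 Γ

  ◇R   : ∀ {w φ} u → (w ∶ ◇ φ) ∈ Γ →
         Derivable n 𝓡 ((u ∶ φ) ∷ Γ) →
         Derivable n 𝓡 Γ

  IOA  : ∀ {v} (u : Ag m → Label) → Fresh v 𝓡 Γ →
         Derivable n (tabulate (λ i → rel i (u i) v) ++ 𝓡) Γ →
         Derivable n 𝓡 Γ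

  agR  : ∀ {w i φ v} → (w ∶ [ i ] φ) ∈ Γ → Fresh v 𝓡 Γ →
         Derivable n (rel i w v ∷ 𝓡) ((v ∶ φ) ∷ Γ) →
         Derivable n 𝓡 Γ

  Pr   : ∀ {w i φ u} → (w ∶ ⟨ i ⟩ φ) ∈ Γ → Path 𝓡 i w u →
         Derivable n 𝓡 ((u ∶ φ) ∷ Γ) →
         Derivable n 𝓡 Γ

  APC  : 0 < n → ∀ i (w : Fin (suc n) → Label) →
         (∀ k j → k Fin.< j → Derivable n (rel i (w k) (w j) ∷ 𝓡) Γ) →
         Derivable n 𝓡 Γ

-- Cut is admissible by structural induction, and with cut every label of a sequent can be
-- made to decide all subformulas of φ, that is, to realize one of finitely many types.  Call
-- a set σ of types refuted if every sequent realizing all of them is derivable.  By downward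
-- induction on σ we may assume that adding any further type to σ gives a refuted set.  Then
-- each label created by a rule may be assumed to realize a type already in σ.  Hence
-- either some rule refutes σ, or σ is closed under all rules and its types, with i-cells
-- given by agreement on the formulas [i]ψ and ⟨i⟩ψ, form a finite, decidable model in which
-- the formulas listed by each type are false.  If φ is valid, every σ with a type listing φ
-- is therefore refuted.  The dichotomies are computed by finite search, without excluded
-- middle.

module Submission where

open import Defs
open import Data.Bool as Bool using (Bool; true; false; if_then_else_)
open import Data.Fin as Fin using (Fin)
open import Data.Fin.Properties as Finₚ using (any?; all?)
open import Data.List as List using (List; []; _∷_; _++_; length; map; concatMap; tabulate)
open import Data.List.Extrema.Nat using (max; xs≤max)
open import Data.List.Membership.Propositional using (_∈_)
open import Data.List.Membership.Propositional.Properties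
  using (∈-++⁺ˡ; ∈-++⁺ʳ; ∈-++⁻; ∈-map⁺; ∈-concatMap⁺; ∈-tabulate⁺; ∈-tabulate⁻; ∈-lookup)
open import Data.List.Relation.Binary.Subset.Propositional using (_⊆_)
open import Data.List.Relation.Binary.Subset.Propositional.Properties using (⊆-refl; xs⊆ys++xs; ∷⁺ʳ)
open import Data.List.Relation.Unary.All as All using (All; []; _∷_)
open import Data.List.Relation.Unary.Any as Any using (here; there)
open import Data.List.Relation.Unary.Any.Properties using (lookup-index)
open import Data.Maybe using (Maybe; just; nothing)
open import Data.Nat using (ℕ; zero; suc; _≤_; _<_; _≟_)
open import Data.Nat.Properties using (1+n≰n; _<?_)
open import Data.Product using (∃; ∃₂; _×_; _,_; proj₁; proj₂)
open import Data.Sum as Sum using (_⊎_; inj₁; inj₂)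
import Data.Sum.Effectful.Left as Sumₗ
open import Data.Unit using (⊤; tt)
open import Data.Vec using (Vec; []; _∷_)
import Data.Vec.Functional as FVec
open import Data.Vec.Properties using (≡-dec; ∷-injective)
open import Function using (_∘_; id)
open import Level using (0ℓ)
import Relation.Binary.Construct.Closure.Equivalence as EqC
import Relation.Binary.Construct.On as On
open import Relation.Binary.PropositionalEquality
  using (_≡_; _≢_; _≗_; refl; sym; cong; cong₂; subst; subst₂; isEquivalence)
open import Relation.Nullary
  using (¬_; Dec; yes; no; does; contradiction; ¬?; _×-dec_; _⊎-dec_; _→-dec_)
open import Relation.Nullary.Decidable using (dec-true)

-- Negation of formulas and updates of relabellings.

neg : ∀ {m} → Formula m → Formula m
neg (atom p)    = natom p
neg (natom p)   = atom p
neg (φ ∧ ψ)     = neg φ ∨ neg ψ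
neg (φ ∨ ψ)     = neg φ ∧ neg ψ
neg (□ φ)       = ◇ neg φ
neg (◇ φ)       = □ neg φ
neg ([ i ] φ)   = ⟨ i ⟩ neg φ
neg (⟨ i ⟩ φ)   = [ i ] neg φ

neg-involutive : ∀ {m} (φ : Formula m) → neg (neg φ) ≡ φ
neg-involutive (atom p)  = refl
neg-involutive (natom p) = refl
neg-involutive (φ ∧ ψ)   = cong₂ _∧_ (neg-involutive φ) (neg-involutive ψ)
neg-involutive (φ ∨ ψ)   = cong₂ _∨_ (neg-involutive φ) (neg-involutive ψ)
neg-involutive (□ φ)     = cong □_ (neg-involutive φ)
neg-involutive (◇ φ)     = cong ◇_ (neg-involutive φ)
neg-involutive ([ i ] φ) = cong [ i ]_ (neg-involutive φ)
neg-involutive (⟨ i ⟩ φ) = cong ⟨ i ⟩_ (neg-involutive φ)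

_[_↦_] : (Label → Label) → Label → Label → Label → Label
(ρ [ v ↦ u ]) x with x ≟ v
... | yes _ = u
... | no  _ = ρ x

update-same : ∀ ρ v u → (ρ [ v ↦ u ]) v ≡ u
update-same ρ v u with v ≟ v
... | yes _  = refl
... | no v≢v = contradiction refl v≢v

update-other : ∀ ρ {v u x} → x ≢ v → (ρ [ v ↦ u ]) x ≡ ρ x
update-other ρ {v} {x = x} x≢v with x ≟ v
... | yes x≡v = contradiction x≡v x≢v
... | no  _   = refl

-- Fresh labels, paths and relabellings of sequents.

module _ {m : ℕ} where

  private variable
    𝓡 𝓡′ 𝓡₁ : List (RelAtom m)
    Γ Γ′ Γ₁ : List (LFormula m)

  fresh : ∀ 𝓡 (Γ : List (LFormula m)) → ∃ λ v → Fresh v 𝓡 Γ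
  fresh 𝓡 Γ = suc (max 0 (labels 𝓡 Γ)) ,
              λ v∈ → 1+n≰n (All.lookup (xs≤max 0 (labels 𝓡 Γ)) v∈)

  label∈labels : ∀ 𝓡 {w φ} → (w ∶ φ) ∈ Γ → w ∈ labels 𝓡 Γ
  label∈labels 𝓡 w∈ = ∈-++⁺ʳ (concatMap _ 𝓡) (∈-map⁺ LFormula.label w∈)

  source∈labels : ∀ {i x y} → rel i x y ∈ 𝓡 → x ∈ labels 𝓡 Γ
  source∈labels r = ∈-++⁺ˡ (∈-concatMap⁺ _ (Any.map (λ { refl → here refl }) r))

  target∈labels : ∀ {i x y} → rel i x y ∈ 𝓡 → y ∈ labels 𝓡 Γ
  target∈labels r = ∈-++⁺ˡ (∈-concatMap⁺ _ (Any.map (λ { refl → there (here refl) }) r))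

  ∈⇒≢ : ∀ 𝓡 (Γ : List (LFormula m)) {v x} → Fresh v 𝓡 Γ → x ∈ labels 𝓡 Γ → x ≢ v
  ∈⇒≢ _ _ v∉ x∈ refl = v∉ x∈

  -- Atoms may go to paths: a path is all that `Pr` asks for, and an atom between labels already
  -- connected can then be dropped by a relabelling.
  RelHom : (Label → Label) → List (RelAtom m) → List (RelAtom m) → Set
  RelHom ρ 𝓡₁ 𝓡 = ∀ {i x y} → rel i x y ∈ 𝓡₁ → Path 𝓡 i (ρ x) (ρ y)

  path-⊆ : ∀ {i x y} → 𝓡 ⊆ 𝓡′ → Path 𝓡 i x y → Path 𝓡′ i x y
  path-⊆ 𝓡⊆ = EqC.map 𝓡⊆

  path-hom : ∀ {ρ i x y} → RelHom ρ 𝓡₁ 𝓡 → Path 𝓡₁ i x y → Path 𝓡 i (ρ x) (ρ y)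
  path-hom {ρ = ρ} h = EqC.gfold (EqC.isEquivalence _) ρ h

  path-trans : ∀ {i x y z} → Path 𝓡 i x y → Path 𝓡 i y z → Path 𝓡 i x z
  path-trans = EqC.transitive _

  path-sym : ∀ {i x y} → Path 𝓡 i x y → Path 𝓡 i y x
  path-sym = EqC.symmetric _

  relHom-id : 𝓡 ⊆ 𝓡′ → RelHom id 𝓡 𝓡′
  relHom-id 𝓡⊆ = EqC.return ∘ 𝓡⊆

  relHom-∷ : ∀ {ρ i x y} → Path 𝓡 i (ρ x) (ρ y) → RelHom ρ 𝓡₁ 𝓡 → RelHom ρ (rel i x y ∷ 𝓡₁) 𝓡
  relHom-∷ p h (here refl) = p
  relHom-∷ p h (there r)   = h r

  relHom-tabulate : ∀ {ρ v} (u : Ag m → Label) → RelHom ρ 𝓡₁ 𝓡 →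
    RelHom ρ (tabulate (λ i → rel i (u i) v) ++ 𝓡₁) (tabulate (λ i → rel i (ρ (u i)) (ρ v)) ++ 𝓡)
  relHom-tabulate {𝓡 = 𝓡} {ρ = ρ} {v} u h r with ∈-++⁻ (tabulate (λ i → rel i (u i) v)) r
  ... | inj₂ r′ = path-⊆ (xs⊆ys++xs 𝓡 _) (h r′)
  ... | inj₁ r′ with ∈-tabulate⁻ r′
  ...   | i , refl = EqC.return (∈-++⁺ˡ (∈-tabulate⁺ {f = λ i → rel i (ρ (u i)) (ρ v)} i))

  relHom-update : ∀ {ρ v u} Γ₁ → Fresh v 𝓡₁ Γ₁ → RelHom ρ 𝓡₁ 𝓡 → RelHom (ρ [ v ↦ u ]) 𝓡₁ 𝓡
  relHom-update {𝓡₁ = 𝓡₁} {𝓡 = 𝓡} {ρ = ρ} Γ₁ v∉ h {i} r =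
    subst₂ (Path 𝓡 i) (sym (update-other ρ (∈⇒≢ 𝓡₁ Γ₁ v∉ (source∈labels r))))
                      (sym (update-other ρ (∈⇒≢ 𝓡₁ Γ₁ v∉ (target∈labels r)))) (h r)

  -- Weakening, cut elimination and general axioms.

  module _ {n : ℕ} where

    -- What the premises of a rule with principal formula w ∶ φ provide, once the
    -- eigenvariable of that rule is replaced by arbitrary labels.  For [ i ] φ a label u
    -- reached by a path would do instead of an atom, but that form is not monotone in 𝓡.
    Premises : List (RelAtom m) → List (LFormula m) → Label → Formula m → Set
    Premises 𝓡 Γ w (atom p)  = (w ∶ natom p) ∈ Γ
    Premises 𝓡 Γ w (natom p) = (w ∶ atom p) ∈ Γ
    Premises 𝓡 Γ w (φ ∧ ψ)   = Derivable n 𝓡 ((w ∶ φ) ∷ Γ) × Derivable n 𝓡 ((w ∶ ψ) ∷ Γ)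
    Premises 𝓡 Γ w (φ ∨ ψ)   = Derivable n 𝓡 ((w ∶ φ) ∷ (w ∶ ψ) ∷ Γ)
    Premises 𝓡 Γ w (□ φ)     = ∀ u → Derivable n 𝓡 ((u ∶ φ) ∷ Γ)
    Premises 𝓡 Γ w (◇ φ)     = ∃ λ u → Derivable n 𝓡 ((u ∶ φ) ∷ Γ)
    Premises 𝓡 Γ w ([ i ] φ) = ∀ u → Derivable n (rel i w u ∷ 𝓡) ((u ∶ φ) ∷ Γ)
    Premises 𝓡 Γ w (⟨ i ⟩ φ) = ∃ λ u → Path 𝓡 i w u × Derivable n 𝓡 ((u ∶ φ) ∷ Γ)

    -- Replays a derivation along a relabelling ρ while eliminating at most one labelled
    -- formula.  With nothing to eliminate this is substitution and weakening; cut
    -- elimination uses it once for each of the two premises.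
    module Replay
      (cut : Maybe (LFormula m))
      (K : List (RelAtom m) → List (LFormula m) → Set)
      (K-mono : ∀ {𝓡 𝓡′ Γ Γ′} → 𝓡 ⊆ 𝓡′ → Γ ⊆ Γ′ → K 𝓡 Γ → K 𝓡′ Γ′)
      (principal : ∀ {𝓡 Γ w φ} → cut ≡ just (w ∶ φ) → Premises 𝓡 Γ w φ → K 𝓡 Γ → Derivable n 𝓡 Γ)
      where

      ForHom : (Label → Label) → List (LFormula m) → List (LFormula m) → Set
      ForHom ρ Γ₁ Γ = ∀ {w φ} → (w ∶ φ) ∈ Γ₁ → cut ≡ just (ρ w ∶ φ) ⊎ (ρ w ∶ φ) ∈ Γ

      forHom-∷ : ∀ {ρ w w′ φ} → ρ w ≡ w′ → ForHom ρ Γ₁ Γ → ForHom ρ ((w ∶ φ) ∷ Γ₁) ((w′ ∶ φ) ∷ Γ)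
      forHom-∷ refl h (here refl) = inj₂ (here refl)
      forHom-∷ refl h (there w∈)  = Sum.map₂ there (h w∈)

      forHom-update : ∀ {ρ v u} 𝓡₁ → Fresh v 𝓡₁ Γ₁ → ForHom ρ Γ₁ Γ → ForHom (ρ [ v ↦ u ]) Γ₁ Γ
      forHom-update {Γ = Γ} {ρ = ρ} 𝓡₁ v∉ h {φ = φ} w∈ =
        subst (λ x → cut ≡ just (x ∶ φ) ⊎ (x ∶ φ) ∈ Γ)
              (sym (update-other ρ (∈⇒≢ 𝓡₁ _ v∉ (label∈labels 𝓡₁ w∈)))) (h w∈)

      -- By recursion on the derivation. `K` carries the other premise of a cut along, weakened on
      -- the way; where the eliminated formula is principal, `principal` receives premises from
      -- which it is already gone.
      replay : ∀ {ρ} → Derivable n 𝓡₁ Γ₁ → RelHom ρ 𝓡₁ 𝓡 → ForHom ρ Γ₁ Γ → K 𝓡 Γ → Derivable n 𝓡 Γ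
      replay (idR p∈ p̄∈) r f k with f p∈ | f p̄∈
      ... | inj₂ p∈′  | inj₂ p̄∈′   = idR p∈′ p̄∈′
      ... | inj₂ p∈′  | inj₁ eq    = principal eq p∈′ k
      ... | inj₁ eq   | inj₂ p̄∈′   = principal eq p̄∈′ k
      ... | inj₁ refl | inj₁ ()
      replay (∧R w∈ d e) r f k with f w∈
      ... | inj₁ eq  = principal eq
                         ( replay d r (forHom-∷ refl f) (K-mono ⊆-refl there k)
                         , replay e r (forHom-∷ refl f) (K-mono ⊆-refl there k)) k
      ... | inj₂ w∈′ = ∧R w∈′ (replay d r (forHom-∷ refl f) (K-mono ⊆-refl there k))
                              (replay e r (forHom-∷ refl f) (K-mono ⊆-refl there k))
      replay {𝓡 = 𝓡} {Γ = Γ} {ρ = ρ} (∨R {w} {φ} {ψ} w∈ d) r f k = by-cases (f w∈)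
        where
        premise : Derivable n 𝓡 ((ρ w ∶ φ) ∷ (ρ w ∶ ψ) ∷ Γ)
        premise = replay d r (forHom-∷ refl (forHom-∷ refl f)) (K-mono ⊆-refl (there ∘ there) k)
        by-cases : cut ≡ just (ρ w ∶ φ ∨ ψ) ⊎ (ρ w ∶ φ ∨ ψ) ∈ Γ → Derivable n 𝓡 Γ
        by-cases (inj₁ eq)  = principal eq premise k
        by-cases (inj₂ w∈′) = ∨R w∈′ premise
      replay {𝓡₁ = 𝓡₁} {Γ₁ = Γ₁} {𝓡 = 𝓡} {Γ = Γ} {ρ = ρ} (□R {w} {φ} {v} w∈ v∉ d) r f k =
        by-cases (f w∈)
        where
        premise : ∀ u → Derivable n 𝓡 ((u ∶ φ) ∷ Γ)
        premise u = replay d (relHom-update Γ₁ v∉ r)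
                      (forHom-∷ (update-same ρ v u) (forHom-update 𝓡₁ v∉ f))
                      (K-mono ⊆-refl there k)
        by-cases : cut ≡ just (ρ w ∶ □ φ) ⊎ (ρ w ∶ □ φ) ∈ Γ → Derivable n 𝓡 Γ
        by-cases (inj₁ eq)  = principal eq premise k
        by-cases (inj₂ w∈′) = let u , u∉ = fresh 𝓡 Γ in □R w∈′ u∉ (premise u)
      replay {ρ = ρ} (◇R u w∈ d) r f k with f w∈
      ... | inj₁ eq  = principal eq (ρ u , replay d r (forHom-∷ refl f) (K-mono ⊆-refl there k)) k
      ... | inj₂ w∈′ = ◇R (ρ u) w∈′ (replay d r (forHom-∷ refl f) (K-mono ⊆-refl there k))
      replay {𝓡₁ = 𝓡₁} {Γ₁ = Γ₁} {𝓡 = 𝓡} {Γ = Γ} {ρ = ρ} (IOA {v} u v∉ d) r f k =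
        let v′ , v′∉ = fresh 𝓡 Γ
            ρ′ = ρ [ v ↦ v′ ]
        -- `ρ′` acts on `u` too: freshness concerns the conclusion only, so some `u i` may be `v`
        -- itself.
        in IOA (ρ′ ∘ u) v′∉
             (subst (λ x → Derivable n (tabulate (λ i → rel i (ρ′ (u i)) x) ++ 𝓡) Γ)
                    (update-same ρ v v′)
                    (replay d (relHom-tabulate u (relHom-update Γ₁ v∉ r)) (forHom-update 𝓡₁ v∉ f)
                            (K-mono (xs⊆ys++xs 𝓡 _) ⊆-refl k)))
      replay {𝓡₁ = 𝓡₁} {Γ₁ = Γ₁} {𝓡 = 𝓡} {Γ = Γ} {ρ = ρ} (agR {w} {i} {φ} {v} w∈ v∉ d) r f k =
        by-cases (f w∈)
        where
        premise : ∀ u → Derivable n (rel i (ρ w) u ∷ 𝓡) ((u ∶ φ) ∷ Γ)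
        premise u =
          replay d
            (relHom-∷ (subst₂ (Path _ i)
                         (sym (update-other ρ (∈⇒≢ 𝓡₁ Γ₁ v∉ (label∈labels 𝓡₁ w∈))))
                         (sym (update-same ρ v u)) (EqC.return (here refl)))
                      (relHom-update Γ₁ v∉ (path-⊆ there ∘ r)))
            (forHom-∷ (update-same ρ v u) (forHom-update 𝓡₁ v∉ f))
            (K-mono there there k)
        by-cases : cut ≡ just (ρ w ∶ [ i ] φ) ⊎ (ρ w ∶ [ i ] φ) ∈ Γ → Derivable n 𝓡 Γ
        by-cases (inj₁ eq)  = principal eq premise k
        by-cases (inj₂ w∈′) = let u , u∉ = fresh 𝓡 Γ in agR w∈′ u∉ (premise u)
      replay {ρ = ρ} (Pr {u = u} w∈ p d) r f k with f w∈
      ... | inj₁ eq  = principal eq (ρ u , path-hom r p ,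
                                     replay d r (forHom-∷ refl f) (K-mono ⊆-refl there k)) k
      ... | inj₂ w∈′ = Pr w∈′ (path-hom r p) (replay d r (forHom-∷ refl f) (K-mono ⊆-refl there k))
      replay {ρ = ρ} (APC 0<n i w d) r f k = APC 0<n i (ρ ∘ w) λ a b a<b →
        replay (d a b a<b) (relHom-∷ (EqC.return (here refl)) (path-⊆ there ∘ r)) f (K-mono there ⊆-refl k)

      eliminate : ∀ {x} → cut ≡ just x → Derivable n 𝓡 (x ∷ Γ) → K 𝓡 Γ → Derivable n 𝓡 Γ
      eliminate eq d k =
        replay {ρ = id} d (relHom-id ⊆-refl) (λ { (here refl) → inj₁ eq ; (there w∈) → inj₂ w∈ }) k

    relabel : ∀ {ρ} → RelHom ρ 𝓡 𝓡′ → (∀ {w φ} → (w ∶ φ) ∈ Γ → (ρ w ∶ φ) ∈ Γ′) →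
              Derivable n 𝓡 Γ → Derivable n 𝓡′ Γ′
    relabel r f d = Replay.replay nothing (λ _ _ → ⊤) (λ _ _ _ → tt) (λ ()) d r (inj₂ ∘ f) tt

    weaken : 𝓡 ⊆ 𝓡′ → Γ ⊆ Γ′ → Derivable n 𝓡 Γ → Derivable n 𝓡′ Γ′
    weaken 𝓡⊆ Γ⊆ = relabel (relHom-id 𝓡⊆) Γ⊆

    -- The relabelling `id` sends the extra atom to the path. In `reduce` this fits the arbitrary
    -- successor of `[ i ] φ` to a label that `⟨ i ⟩` reaches only by a path.
    path-contract : ∀ {i x y} → Path 𝓡 i x y → Derivable n (rel i x y ∷ 𝓡) Γ → Derivable n 𝓡 Γ
    path-contract p = relabel (relHom-∷ p (relHom-id ⊆-refl)) id

    exchange : ∀ {x y} → Derivable n 𝓡 (x ∷ y ∷ Γ) → Derivable n 𝓡 (y ∷ x ∷ Γ)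
    exchange = weaken ⊆-refl λ { (here refl)         → there (here refl)
                               ; (there (here refl)) → here refl
                               ; (there (there z∈))  → there (there z∈) }

    premises-mono : ∀ {w} φ → 𝓡 ⊆ 𝓡′ → Γ ⊆ Γ′ → Premises 𝓡 Γ w φ → Premises 𝓡′ Γ′ w φ
    premises-mono (atom p)  𝓡⊆ Γ⊆ p̄∈ = Γ⊆ p̄∈
    premises-mono (natom p) 𝓡⊆ Γ⊆ p∈ = Γ⊆ p∈
    premises-mono (φ ∧ ψ)   𝓡⊆ Γ⊆ (d , e) = weaken 𝓡⊆ (∷⁺ʳ _ Γ⊆) d , weaken 𝓡⊆ (∷⁺ʳ _ Γ⊆) e
    premises-mono (φ ∨ ψ)   𝓡⊆ Γ⊆ d = weaken 𝓡⊆ (∷⁺ʳ _ (∷⁺ʳ _ Γ⊆)) d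
    premises-mono (□ φ)     𝓡⊆ Γ⊆ d u = weaken 𝓡⊆ (∷⁺ʳ _ Γ⊆) (d u)
    premises-mono (◇ φ)     𝓡⊆ Γ⊆ (u , d) = u , weaken 𝓡⊆ (∷⁺ʳ _ Γ⊆) d
    premises-mono ([ i ] φ) 𝓡⊆ Γ⊆ d u = weaken (∷⁺ʳ _ 𝓡⊆) (∷⁺ʳ _ Γ⊆) (d u)
    premises-mono (⟨ i ⟩ φ) 𝓡⊆ Γ⊆ (u , p , d) = u , path-⊆ 𝓡⊆ p , weaken 𝓡⊆ (∷⁺ʳ _ Γ⊆) d

    -- Two nested replays. The outer one removes `φ` from the first derivation; wherever `φ` is
    -- principal, the inner one removes `neg φ` from the second, keeping the premises found for `φ`.
    -- Where both are principal, `reduce` cuts on immediate subformulas only, so the recursion ends.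
    cut : ∀ {w} φ → Derivable n 𝓡 ((w ∶ φ) ∷ Γ) → Derivable n 𝓡 ((w ∶ neg φ) ∷ Γ) → Derivable n 𝓡 Γ
    reduce : ∀ {w} φ → Premises 𝓡 Γ w φ → Premises 𝓡 Γ w (neg φ) → Derivable n 𝓡 Γ

    cut {w = w} φ d e = Replay.eliminate (just (w ∶ φ)) (λ 𝓡 Γ → Derivable n 𝓡 ((w ∶ neg φ) ∷ Γ))
      (λ 𝓡⊆ Γ⊆ → weaken 𝓡⊆ (∷⁺ʳ _ Γ⊆))
      (λ { refl ps e′ → Replay.eliminate (just (w ∶ neg φ)) (λ 𝓡 Γ → Premises 𝓡 Γ w φ) (premises-mono φ)
        (λ { refl qs ps′ → reduce φ ps′ qs }) refl e′ ps })
      refl d e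

    reduce (atom p)  p̄∈ p∈ = idR p∈ p̄∈
    reduce (natom p) p∈ p̄∈ = idR p∈ p̄∈
    reduce (φ ∧ ψ) (d , e) f = cut φ d (cut ψ (weaken ⊆-refl (∷⁺ʳ _ there) e) (exchange f))
    reduce (φ ∨ ψ) f (d , e) = cut φ (cut ψ (exchange f) (weaken ⊆-refl (∷⁺ʳ _ there) e)) d
    reduce (□ φ) d (u , e) = cut φ (d u) e
    reduce (◇ φ) (u , d) e = cut φ d (e u)
    reduce ([ i ] φ) d (u , p , e) = cut φ (path-contract p (d u)) e
    reduce (⟨ i ⟩ φ) (u , p , d) e = cut φ d (path-contract p (e u))

    -- A fresh `i`-successor of `w` is reached from `u` through `w`, so both bodies meet at it and
    -- `ax` applies.
    box-diamond : ∀ {i w u φ ψ} →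
      (∀ {𝓡 Γ v} → (v ∶ φ) ∈ Γ → (v ∶ ψ) ∈ Γ → Derivable n 𝓡 Γ) →
      (w ∶ [ i ] φ) ∈ Γ → (u ∶ ⟨ i ⟩ ψ) ∈ Γ → Path 𝓡 i u w → Derivable n 𝓡 Γ
    box-diamond {Γ = Γ} {𝓡 = 𝓡} ax w∈ u∈ p =
      let v , v∉ = fresh 𝓡 Γ in
      agR w∈ v∉ (Pr (there u∈) (path-trans (path-⊆ there p) (EqC.return (here refl)))
        (ax (there (here refl)) (here refl)))

    identity : ∀ {w} φ → (w ∶ φ) ∈ Γ → (w ∶ neg φ) ∈ Γ → Derivable n 𝓡 Γ
    identity (atom p)  x y = idR x y
    identity (natom p) x y = idR y x
    identity (φ ∧ ψ)   x y = ∨R y (∧R (there (there x)) (identity φ (here refl) (there (here refl)))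
                                                        (identity ψ (here refl) (there (there (here refl)))))
    identity (φ ∨ ψ)   x y = ∨R x (∧R (there (there y)) (identity φ (there (here refl)) (here refl))
                                                        (identity ψ (there (there (here refl))) (here refl)))
    identity {Γ = Γ} {𝓡 = 𝓡} (□ φ) x y =
      let v , v∉ = fresh 𝓡 Γ in □R x v∉ (◇R v (there y) (identity φ (there (here refl)) (here refl)))
    identity {Γ = Γ} {𝓡 = 𝓡} (◇ φ) x y =
      let v , v∉ = fresh 𝓡 Γ in □R y v∉ (◇R v (there x) (identity φ (here refl) (there (here refl))))
    identity ([ i ] φ) x y = box-diamond (λ a b → identity φ a b) x y (EqC.reflexive _)
    identity (⟨ i ⟩ φ) x y = box-diamond (λ a b → identity φ b a) y x (EqC.reflexive _)

  -- Subformulas, modal formulas and types.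

  args : Formula m → List (Formula m)
  args (atom p)  = []
  args (natom p) = []
  args (φ ∧ ψ)   = φ ∷ ψ ∷ []
  args (φ ∨ ψ)   = φ ∷ ψ ∷ []
  args (□ φ)     = φ ∷ []
  args (◇ φ)     = φ ∷ []
  args ([ i ] φ) = φ ∷ []
  args (⟨ i ⟩ φ) = φ ∷ []

  args-neg : ∀ φ → args (neg φ) ≡ map neg (args φ)
  args-neg (atom p)  = refl
  args-neg (natom p) = refl
  args-neg (φ ∧ ψ)   = refl
  args-neg (φ ∨ ψ)   = refl
  args-neg (□ φ)     = refl
  args-neg (◇ φ)     = refl
  args-neg ([ i ] φ) = refl
  args-neg (⟨ i ⟩ φ) = refl

  mutual
    sub : Formula m → List (Formula m)
    sub φ = φ ∷ properSub φ

    properSub : Formula m → List (Formula m)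
    properSub (atom p)  = []
    properSub (natom p) = []
    properSub (φ ∧ ψ)   = sub φ ++ sub ψ
    properSub (φ ∨ ψ)   = sub φ ++ sub ψ
    properSub (□ φ)     = sub φ
    properSub (◇ φ)     = sub φ
    properSub ([ i ] φ) = sub φ
    properSub (⟨ i ⟩ φ) = sub φ

  args⊆properSub : ∀ φ → args φ ⊆ properSub φ
  args⊆properSub (φ ∧ ψ)   (here refl)         = here refl
  args⊆properSub (φ ∧ ψ)   (there (here refl)) = ∈-++⁺ʳ (sub φ) (here refl)
  args⊆properSub (φ ∨ ψ)   (here refl)         = here refl
  args⊆properSub (φ ∨ ψ)   (there (here refl)) = ∈-++⁺ʳ (sub φ) (here refl)
  args⊆properSub (□ φ)     (here refl)         = here refl
  args⊆properSub (◇ φ)     (here refl)         = here refl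
  args⊆properSub ([ i ] φ) (here refl)         = here refl
  args⊆properSub (⟨ i ⟩ φ) (here refl)         = here refl

  mutual
    sub-closed : ∀ φ {ψ} → ψ ∈ sub φ → args ψ ⊆ sub φ
    sub-closed φ (here refl) = there ∘ args⊆properSub φ
    sub-closed φ (there ψ∈)  = there ∘ properSub-closed φ ψ∈

    properSub-closed : ∀ φ {ψ} → ψ ∈ properSub φ → args ψ ⊆ properSub φ
    properSub-closed (φ ∧ χ)   ψ∈ = ++-closed φ χ ψ∈
    properSub-closed (φ ∨ χ)   ψ∈ = ++-closed φ χ ψ∈
    properSub-closed (□ φ)     ψ∈ = sub-closed φ ψ∈
    properSub-closed (◇ φ)     ψ∈ = sub-closed φ ψ∈
    properSub-closed ([ i ] φ) ψ∈ = sub-closed φ ψ∈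
    properSub-closed (⟨ i ⟩ φ) ψ∈ = sub-closed φ ψ∈

    ++-closed : ∀ φ χ {ψ} → ψ ∈ sub φ ++ sub χ → args ψ ⊆ sub φ ++ sub χ
    ++-closed φ χ ψ∈ with ∈-++⁻ (sub φ) ψ∈
    ... | inj₁ ψ∈φ = ∈-++⁺ˡ ∘ sub-closed φ ψ∈φ
    ... | inj₂ ψ∈χ = ∈-++⁺ʳ (sub φ) ∘ sub-closed χ ψ∈χ

  -- The formulas whose truth value is constant on each choice cell of `i`.
  data Modal (i : Ag m) : Formula m → Set where
    box     : ∀ {φ} → Modal i ([ i ] φ)
    diamond : ∀ {φ} → Modal i (⟨ i ⟩ φ)

  modal? : ∀ i φ → Dec (Modal i φ)
  modal? i (atom p)  = no λ ()
  modal? i (natom p) = no λ ()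
  modal? i (φ ∧ ψ)   = no λ ()
  modal? i (φ ∨ ψ)   = no λ ()
  modal? i (□ φ)     = no λ ()
  modal? i (◇ φ)     = no λ ()
  modal? i ([ j ] φ) with i Fin.≟ j
  ... | yes refl = yes box
  ... | no i≢j   = no λ { box → i≢j refl }
  modal? i (⟨ j ⟩ φ) with i Fin.≟ j
  ... | yes refl = yes diamond
  ... | no i≢j   = no λ { diamond → i≢j refl }

  modal-neg : ∀ {i φ} → Modal i φ → Modal i (neg φ)
  modal-neg box     = diamond
  modal-neg diamond = box

  -- Decides the valuation of the counter-model, which is membership of `natom p` in a list.
  natom≟ : ∀ p (φ : Formula m) → Dec (natom p ≡ φ)
  natom≟ p (atom q)  = no λ ()
  natom≟ p (natom q) with p ≟ q
  ... | yes refl = yes refl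
  ... | no p≢q   = no λ { refl → p≢q refl }
  natom≟ p (φ ∧ ψ)   = no λ ()
  natom≟ p (φ ∨ ψ)   = no λ ()
  natom≟ p (□ φ)     = no λ ()
  natom≟ p (◇ φ)     = no λ ()
  natom≟ p ([ i ] φ) = no λ ()
  natom≟ p (⟨ i ⟩ φ) = no λ ()

  -- A type over S decides every formula of S; lits lists the formulas that are false
  -- at a world of that type.
  Type : List (Formula m) → Set
  Type S = Vec Bool (length S)

  -- The polarity is that of a one-sided sequent: the bit `true` lists `φ` itself, which makes `φ`
  -- false.
  signed : Bool → Formula m → Formula m
  signed b φ = if b then φ else neg φ

  lits : ∀ S → Type S → List (Formula m)
  lits []      []      = []
  lits (φ ∷ S) (b ∷ t) = signed b φ ∷ lits S t

  -- The part of a type that worlds in the same choice cell of i must share.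
  choice : Ag m → ∀ S → Type S → Type S
  choice i []      []      = []
  choice i (φ ∷ S) (b ∷ t) = (does (modal? i φ) Bool.∧ b) ∷ choice i S t

  lits-sound : ∀ S t {φ} → φ ∈ lits S t → φ ∈ S ⊎ neg φ ∈ S
  lits-sound []      []          ()
  lits-sound (φ ∷ S) (true ∷ t)  (here refl) = inj₁ (here refl)
  lits-sound (φ ∷ S) (false ∷ t) (here refl) = inj₂ (here (neg-involutive φ))
  lits-sound (φ ∷ S) (b ∷ t)     (there ψ∈)  = Sum.map there there (lits-sound S t ψ∈)

  lits-decide : ∀ S t {φ} → φ ∈ S → φ ∈ lits S t ⊎ neg φ ∈ lits S t
  lits-decide (φ ∷ S) (true ∷ t)  (here refl) = inj₁ (here refl)
  lits-decide (φ ∷ S) (false ∷ t) (here refl) = inj₂ (here refl)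
  lits-decide (φ ∷ S) (b ∷ t)     (there ψ∈)  = Sum.map there there (lits-decide S t ψ∈)

  modal-signed : ∀ {i} b φ → Modal i (signed b φ) → Modal i φ
  modal-signed true  φ mod = mod
  modal-signed false φ mod = subst (Modal _) (neg-involutive φ) (modal-neg mod)

  -- A modal formula of `i` in the list stems from a bit that `choice` leaves unmasked, and equal
  -- choices share it.
  choice-agree : ∀ {i} S t t′ {φ} → choice i S t ≡ choice i S t′ → Modal i φ →
                 φ ∈ lits S t → φ ∈ lits S t′
  choice-agree []      []      []        eq mod ()
  choice-agree {i} (φ ∷ S) (b ∷ t) (b′ ∷ t′) eq mod (here refl)
    -- The entry is modal for `i`, so its mask is `true` and the equation of the heads becomes
    -- `b ≡ b′`.
    with b≡b′ ← proj₁ (∷-injective eq)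
    rewrite dec-true (modal? i φ) (modal-signed b φ mod) = here (cong (λ b → signed b φ) b≡b′)
  choice-agree (φ ∷ S) (b ∷ t) (b′ ∷ t′) eq mod (there φ∈) =
    there (choice-agree S t t′ (proj₂ (∷-injective eq)) mod φ∈)

  -- Masked bits are always equal, so two choices differ at a modal entry, where one type lists the
  -- entry and the other its negation.
  choice-differ : ∀ {i} S t t′ → choice i S t ≢ choice i S t′ →
                  ∃ λ φ → Modal i φ × φ ∈ lits S t × neg φ ∈ lits S t′
  choice-differ []      []      []        neq = contradiction refl neq
  choice-differ {i} (φ ∷ S) (b ∷ t) (b′ ∷ t′) neq with ≡-dec Bool._≟_ (choice i S t) (choice i S t′)
  ... | no neq′ = let ψ , mod , ψ∈ , ψ̄∈ = choice-differ S t t′ neq′ in ψ , mod , there ψ∈ , there ψ̄∈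
  ... | yes eq with modal? i φ | b | b′
  ...   | no _    | _     | _     = contradiction (cong (false ∷_) eq) neq
  ...   | yes _   | true  | true  = contradiction (cong (true ∷_) eq) neq
  ...   | yes _   | false | false = contradiction (cong (false ∷_) eq) neq
  ...   | yes mod | true  | false = φ , mod , here refl , here refl
  ...   | yes mod | false | true  = neg φ , modal-neg mod , here refl , here (neg-involutive φ)

-- Finite enumeration and search.

types : ∀ k → List (Vec Bool k)
types zero    = [] ∷ []
types (suc k) = map (true ∷_) (types k) ++ map (false ∷_) (types k)

∈-types : ∀ {k} (t : Vec Bool k) → t ∈ types k
∈-types []          = here refl
∈-types (true ∷ t)  = ∈-++⁺ˡ (∈-map⁺ _ (∈-types t))
∈-types (false ∷ t) = ∈-++⁺ʳ (map (true ∷_) (types _)) (∈-map⁺ _ (∈-types t))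

-- Traversal in the applicative functor `Q ⊎_`, whose left values abort the search.
sequence-Fin : ∀ {Q : Set} {k} {P : Fin k → Set} → (∀ a → Q ⊎ P a) → Q ⊎ (∀ a → P a)
sequence-Fin {Q} = Finₚ.sequence (Sumₗ.applicative Q 0ℓ)

search-Fin : ∀ {k} {P Q : Fin k → Set} → (∀ a → P a ⊎ Q a) → ∃ P ⊎ (∀ a → Q a)
search-Fin f = sequence-Fin λ a → Sum.map₁ (a ,_) (f a)

-- A function is rebuilt from its head and tail and so recovered only pointwise; hence `P` must
-- respect `≗`.
sequence-functions : ∀ {Q : Set} {l} k {P : (Fin k → Fin l) → Set} → (∀ {f g} → f ≗ g → P f → P g) →
                     (∀ f → Q ⊎ P f) → Q ⊎ (∀ f → P f)
sequence-functions zero    resp h = Sum.map₂ (λ p f → resp (λ ()) p) (h λ ())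
sequence-functions (suc k) resp h = Sum.map₂
  (λ p f → resp (λ { Fin.zero → refl ; (Fin.suc i) → refl }) (p (f Fin.zero) (f ∘ Fin.suc)))
  (sequence-Fin λ a → sequence-functions k
    (λ f≗g → resp λ { Fin.zero → refl ; (Fin.suc i) → f≗g i })
    (λ f → h (a FVec.∷ f)))

-- Sequents that realize types, and refuted sets.

module _ {m n : ℕ} where

  private variable
    𝓡 : List (RelAtom m)
    Γ : List (LFormula m)

  -- One cut per formula of `S`; its two premises are the two values of the bit.
  complete : ∀ S {v} → (∀ t → Derivable n 𝓡 (map (v ∶_) (lits S t) ++ Γ)) → Derivable n 𝓡 Γ
  complete []      h = h []
  complete (φ ∷ S) h = complete S λ t → cut φ (h (true ∷ t)) (h (false ∷ t))

  module Refutation (φ₀ : Formula m) where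

    S : List (Formula m)
    S = sub φ₀

    -- A listed formula may be the negation of one in `S`. Its arguments are then negations of
    -- formulas in `S`, which `t′` decides as well.
    args-decided : ∀ t t′ {φ ψ} → φ ∈ lits S t → ψ ∈ args φ → ψ ∈ lits S t′ ⊎ neg ψ ∈ lits S t′
    args-decided t t′ {φ} {ψ} φ∈ ψ∈ with lits-sound S t φ∈
    ... | inj₁ φ∈S = lits-decide S t′ (sub-closed φ₀ φ∈S ψ∈)
    ... | inj₂ φ̄∈S = Sum.swap (Sum.map₂ (subst (_∈ lits S t′) (neg-involutive ψ))
      (lits-decide S t′ (sub-closed φ₀ φ̄∈S (subst (neg ψ ∈_) (sym (args-neg φ)) (∈-map⁺ neg ψ∈)))))

    Realizes : List (LFormula m) → Label → Type S → Set
    Realizes Γ w t = ∀ {φ} → φ ∈ lits S t → (w ∶ φ) ∈ Γ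

    Realized : List (LFormula m) → List (Type S) → Set
    Realized Γ = All (λ t → ∃ λ w → Realizes Γ w t)

    realized-⊆ : ∀ {Γ Γ′ σ} → Γ ⊆ Γ′ → Realized Γ σ → Realized Γ′ σ
    realized-⊆ Γ⊆ = All.map λ (w , w⊨) → w , λ φ∈ → Γ⊆ (w⊨ φ∈)

    Refuted : List (Type S) → Set
    Refuted σ = ∀ {𝓡 Γ} → Realized Γ σ → Derivable n 𝓡 Γ

    _≈[_]_ : Type S → Ag m → Type S → Set
    t ≈[ i ] t′ = choice i S t ≡ choice i S t′

    _≈[_]?_ : ∀ t i t′ → Dec (t ≈[ i ] t′)
    t ≈[ i ]? t′ = ≡-dec Bool._≟_ (choice i S t) (choice i S t′)

    -- Types in different cells disagree on a modal formula of `i`: a box at one label and its dual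
    -- diamond at the other, which `box-diamond` brings together.
    clash : ∀ {i t t′ w w′} → ¬ t ≈[ i ] t′ → Realizes Γ w t → Realizes Γ w′ t′ →
            Path 𝓡 i w w′ → Derivable n 𝓡 Γ
    clash {i = i} {t} {t′} t≉t′ w⊨ w′⊨ p with choice-differ {i = i} S t t′ t≉t′
    ... | _ , box {φ} , φ∈ , φ̄∈ = box-diamond (λ a b → identity φ a b) (w⊨ φ∈) (w′⊨ φ̄∈) (path-sym p)
    ... | _ , diamond {φ} , φ∈ , φ̄∈ = box-diamond (λ a b → identity φ b a) (w′⊨ φ̄∈) (w⊨ φ∈) p

    -- Saturated sets: refutation, or the conditions for a model.

    module Saturated (σ : List (Type S)) (maximal : ∀ t → t ∈ σ ⊎ Refuted (t ∷ σ)) where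

      World : Set
      World = Fin (length σ)

      type : World → Type S
      type = List.lookup σ

      infix 4 _⊣_
      _⊣_ : Formula m → World → Set
      φ ⊣ a = φ ∈ lits S (type a)

      realizer : Realized Γ σ → ∀ a → ∃ λ w → Realizes Γ w (type a)
      realizer r a = All.lookup r (∈-lookup a)

      -- After `complete`, `v` realizes some type. If that type is not in `σ`, it refutes `σ` by
      -- maximality and the branch is closed.
      extend : ∀ {v} → Realized Γ σ →
               (∀ {Γ′} a → Γ ⊆ Γ′ → Realizes Γ′ v (type a) → Derivable n 𝓡 Γ′) → Derivable n 𝓡 Γ
      extend {Γ = Γ} {𝓡 = 𝓡} {v} r h = complete S λ t → by-cases t (maximal t)
        where
        by-cases : ∀ t → t ∈ σ ⊎ Refuted (t ∷ σ) → Derivable n 𝓡 (map (v ∶_) (lits S t) ++ Γ)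
        by-cases t (inj₁ t∈) = h (Any.index t∈) (∈-++⁺ʳ _) λ {φ} φ∈ →
          ∈-++⁺ˡ (∈-map⁺ (v ∶_) (subst (λ t → φ ∈ lits S t) (sym (lookup-index t∈)) φ∈))
        by-cases t (inj₂ refuted) = refuted
          ((v , λ φ∈ → ∈-++⁺ˡ (∈-map⁺ (v ∶_) φ∈)) ∷ realized-⊆ (∈-++⁺ʳ _) r)

      extend-∷ : ∀ {v x} → Realized Γ σ →
                 (∀ {Γ′} a → Γ ⊆ Γ′ → x ∈ Γ′ → Realizes Γ′ v (type a) → Derivable n 𝓡 Γ′) →
                 Derivable n 𝓡 (x ∷ Γ)
      extend-∷ r h = extend (realized-⊆ there r)
                       λ a Γ⊆ → h a (Γ⊆ ∘ there) (Γ⊆ (here refl))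

      -- Listed formulas are to be false, so each clause reduces the falsity of a formula to that of
      -- its parts. The atomic clauses anticipate a valuation that makes `p` true exactly where
      -- `natom p` is listed.
      Hintikka : World → Formula m → Set
      Hintikka a (atom p)  = ¬ natom p ⊣ a
      Hintikka a (natom p) = ⊤
      Hintikka a (φ ∧ ψ)   = φ ⊣ a ⊎ ψ ⊣ a
      Hintikka a (φ ∨ ψ)   = φ ⊣ a × ψ ⊣ a
      Hintikka a (□ φ)     = ∃ λ b → φ ⊣ b
      Hintikka a (◇ φ)     = ∀ b → φ ⊣ b
      Hintikka a ([ i ] φ) = ∃ λ b → type a ≈[ i ] type b × φ ⊣ b
      Hintikka a (⟨ i ⟩ φ) = ∀ b → type a ≈[ i ] type b → φ ⊣ b

      natom⊣? : ∀ p a → Dec (natom p ⊣ a)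
      natom⊣? p a = Any.any? (natom≟ p) (lits S (type a))

      decide : ∀ {a φ ψ} b → φ ⊣ a → ψ ∈ args φ → ψ ⊣ b ⊎ neg ψ ⊣ b
      decide {a} b = args-decided (type a) (type b)

      -- If a clause fails for a compound formula, `decide` supplies the negations of the missing
      -- parts, and the rule for `φ` followed by `identity` derives every sequent realizing `σ`.
      hintikka : ∀ a φ → φ ⊣ a → Refuted σ ⊎ Hintikka a φ
      hintikka a (atom p) φ∈ with natom⊣? p a
      ... | no  p̄∉ = inj₂ p̄∉
      ... | yes p̄∈ = inj₁ λ r → let w , w⊨ = realizer r a in idR (w⊨ φ∈) (w⊨ p̄∈)
      hintikka a (natom p) φ∈ = inj₂ tt
      hintikka a (φ ∧ ψ) φ∈ with decide {a} a φ∈ (here refl) | decide {a} a φ∈ (there (here refl))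
      ... | inj₁ φ∈a | _        = inj₂ (inj₁ φ∈a)
      ... | inj₂ _   | inj₁ ψ∈a = inj₂ (inj₂ ψ∈a)
      ... | inj₂ φ̄∈  | inj₂ ψ̄∈  = inj₁ λ r → let w , w⊨ = realizer r a in
        ∧R (w⊨ φ∈) (identity φ (here refl) (there (w⊨ φ̄∈))) (identity ψ (here refl) (there (w⊨ ψ̄∈)))
      hintikka a (φ ∨ ψ) φ∈ with decide {a} a φ∈ (here refl) | decide {a} a φ∈ (there (here refl))
      ... | inj₁ φ∈a | inj₁ ψ∈a = inj₂ (φ∈a , ψ∈a)
      ... | inj₂ φ̄∈  | _        = inj₁ λ r → let w , w⊨ = realizer r a in
        ∨R (w⊨ φ∈) (identity φ (here refl) (there (there (w⊨ φ̄∈))))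
      ... | inj₁ _   | inj₂ ψ̄∈  = inj₁ λ r → let w , w⊨ = realizer r a in
        ∨R (w⊨ φ∈) (identity ψ (there (here refl)) (there (there (w⊨ ψ̄∈))))
      hintikka a (□ φ) φ∈ with search-Fin (λ b → decide {a} b φ∈ (here refl))
      ... | inj₁ witness = inj₂ witness
      ... | inj₂ φ̄∈ = inj₁ λ {𝓡} {Γ} r → let w , w⊨ = realizer r a ; v , v∉ = fresh 𝓡 Γ in
        □R (w⊨ φ∈) v∉ (extend-∷ {v = v} r λ b _ x∈ v⊨ → identity φ x∈ (v⊨ (φ̄∈ b)))
      hintikka a (◇ φ) φ∈ = sequence-Fin λ b → Sum.swap (Sum.map₂
        (λ φ̄∈ r → let w , w⊨ = realizer r a ; u , u⊨ = realizer r b in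
          ◇R u (w⊨ φ∈) (identity φ (here refl) (there (u⊨ φ̄∈))))
        (decide {a} b φ∈ (here refl)))
      hintikka a ([ i ] φ) φ∈ = Sum.swap (Sum.map₂
        -- Any type of `σ` for the new successor either lies outside the cell of `a`, against the
        -- new atom, or lists `neg φ`.
        (λ unfit {𝓡} {Γ} r → let w , w⊨ = realizer r a ; v , v∉ = fresh 𝓡 Γ in
          agR (w⊨ φ∈) v∉ (extend-∷ {v = v} r λ b Γ⊆ x∈ v⊨ → Sum.[
            (λ a≉b → clash a≉b (Γ⊆ ∘ w⊨) v⊨ (EqC.return (here refl))) ,
            (λ φ̄∈b → identity φ x∈ (v⊨ φ̄∈b)) ] (unfit b)))
        (search-Fin candidate))
        where
        candidate : ∀ b → (type a ≈[ i ] type b × φ ⊣ b) ⊎ (¬ type a ≈[ i ] type b ⊎ neg φ ⊣ b)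
        candidate b with type a ≈[ i ]? type b | decide {a} b φ∈ (here refl)
        ... | no a≉b  | _        = inj₂ (inj₁ a≉b)
        ... | yes _   | inj₂ φ̄∈b = inj₂ (inj₂ φ̄∈b)
        ... | yes a≈b | inj₁ φ∈b = inj₁ (a≈b , φ∈b)
      hintikka a (⟨ i ⟩ φ) φ∈ = sequence-Fin λ b → by-cases b (type a ≈[ i ]? type b)
        where
        by-cases : ∀ b → Dec (type a ≈[ i ] type b) → Refuted σ ⊎ (type a ≈[ i ] type b → φ ⊣ b)
        by-cases b (no a≉b) = inj₂ λ a≈b → contradiction a≈b a≉b
        by-cases b (yes a≈b) with decide {a} b φ∈ (here refl)
        ... | inj₁ φ∈b = inj₂ λ _ → φ∈b
        ... | inj₂ φ̄∈b = inj₁ λ r → let w , w⊨ = realizer r b in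
          -- The diamond is listed at `b` too, as `a` and `b` share a cell, so `Pr` applies there
          -- with the empty path.
          Pr (w⊨ (choice-agree S (type a) (type b) a≈b diamond φ∈)) (EqC.reflexive _)
             (identity φ (here refl) (there (w⊨ φ̄∈b)))

      Independent : Set
      Independent = (u : Ag m → World) → ∃ λ b → ∀ i → type (u i) ≈[ i ] type b

      LimitedChoice : Set
      LimitedChoice = 0 < n → ∀ i (w : Fin (suc n) → World) →
                      ∃₂ λ (k j : Fin (suc n)) → k Fin.< j × type (w k) ≈[ i ] type (w j)

      -- If no world meets all the chosen cells, `IOA` creates a label that clashes for some agent
      -- whichever type of `σ` it realizes.
      independent : Refuted σ ⊎ Independent
      independent = sequence-functions m
        (λ f≗g (b , f≈b) → b , λ i → subst (λ a → type a ≈[ i ] type b) (f≗g i) (f≈b i))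
        λ u → by-cases u (search-Fin (member u))
        where
        member : ∀ u b → (∀ i → type (u i) ≈[ i ] type b) ⊎ (∃ λ i → ¬ type (u i) ≈[ i ] type b)
        member u b = Sum.swap (sequence-Fin λ i → decision i (type (u i) ≈[ i ]? type b))
          where
          decision : ∀ i → Dec (type (u i) ≈[ i ] type b) →
                     (∃ λ i → ¬ type (u i) ≈[ i ] type b) ⊎ type (u i) ≈[ i ] type b
          decision i (yes p) = inj₂ p
          decision i (no ¬p) = inj₁ (i , ¬p)
        by-cases : ∀ u →
          (∃ λ b → ∀ i → type (u i) ≈[ i ] type b) ⊎ (∀ b → ∃ λ i → ¬ type (u i) ≈[ i ] type b) →
          Refuted σ ⊎ (∃ λ b → ∀ i → type (u i) ≈[ i ] type b)
        by-cases u (inj₁ witness) = inj₂ witness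
        by-cases u (inj₂ unfit) = inj₁ λ {𝓡} {Γ} r →
          let v , v∉ = fresh 𝓡 Γ
              ℓ = λ i → proj₁ (realizer r (u i))
          in IOA ℓ v∉ (extend {v = v} r λ b Γ⊆ v⊨ →
               let i , u≉b = unfit b in
               clash u≉b (Γ⊆ ∘ proj₂ (realizer r (u i))) v⊨
                 (EqC.return (∈-++⁺ˡ (∈-tabulate⁺ {f = λ i → rel i (ℓ i) v} i))))

      -- If `suc n` worlds lie in pairwise different cells, each premise of `APC` joins two of their
      -- realizers and is a clash.
      limitedChoice : Refuted σ ⊎ LimitedChoice
      limitedChoice with 0 <? n
      ... | no 0≮n = inj₂ λ 0<n → contradiction 0<n 0≮n
      ... | yes 0<n = Sum.map₂ (λ h _ → h) (sequence-Fin λ i → sequence-functions (suc n)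
          (λ f≗g (k , j , k<j , k≈j) → k , j , k<j ,
            subst₂ (λ a b → type a ≈[ i ] type b) (f≗g k) (f≗g j) k≈j)
          λ w → by-cases i w (any? λ k → any? λ j → (k Finₚ.<? j) ×-dec (type (w k) ≈[ i ]? type (w j))))
        where
        by-cases : ∀ i (w : Fin (suc n) → World) →
          Dec (∃₂ λ k j → k Fin.< j × type (w k) ≈[ i ] type (w j)) →
          Refuted σ ⊎ (∃₂ λ k j → k Fin.< j × type (w k) ≈[ i ] type (w j))
        by-cases i w (yes pair) = inj₂ pair
        by-cases i w (no ¬pair) = inj₁ λ r →
          APC 0<n i (λ k → proj₁ (realizer r (w k))) λ k j k<j →
            clash (λ k≈j → ¬pair (k , j , k<j , k≈j))
              (proj₂ (realizer r (w k))) (proj₂ (realizer r (w j))) (EqC.return (here refl))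

      all-hintikka : Refuted σ ⊎ (∀ a φ → φ ⊣ a → Hintikka a φ)
      all-hintikka = sequence-Fin λ a → Sum.map₂ (λ h φ φ∈ → All.lookup h φ∈)
        (All.sequenceA 0ℓ (Sumₗ.applicative (Refuted σ) 0ℓ) (All.tabulate λ {φ} → hintikka a φ))

      -- The finite counter-model.

      module CounterModel (a₀ : World) (ind : Independent) (lim : LimitedChoice)
                          (hin : ∀ a φ → φ ⊣ a → Hintikka a φ) where

        model : Model m n
        model = record
          { frame = record
            { W             = World
            ; inhabited     = a₀
            ; R             = λ i a b → type a ≈[ i ] type b
            ; isEquivalence = λ i → On.isEquivalence (choice i S ∘ type) isEquivalence
            ; independence  = ind
            ; limitedChoice = lim
            }
          -- A listed `natom p` is false, so `p` is true.
          ; V = λ p a → natom p ⊣ a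
          }

        -- The truth lemma in its falsity half, by induction on `φ` with one clause of `Hintikka`
        -- per connective.
        falsifies : ∀ a φ → φ ⊣ a → ¬ (model , a ⊩ φ)
        falsifies a (atom p)  φ∈ h             = hin a (atom p) φ∈ h
        falsifies a (natom p) φ∈ h             = h φ∈
        falsifies a (φ ∧ ψ)   φ∈ (h , h′)      =
          Sum.[ (λ x → falsifies a φ x h) , (λ x → falsifies a ψ x h′) ] (hin a _ φ∈)
        falsifies a (φ ∨ ψ)   φ∈ (inj₁ h)      = falsifies a φ (proj₁ (hin a _ φ∈)) h
        falsifies a (φ ∨ ψ)   φ∈ (inj₂ h)      = falsifies a ψ (proj₂ (hin a _ φ∈)) h
        falsifies a (□ φ)     φ∈ h             = let b , x = hin a _ φ∈ in falsifies b φ x (h b)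
        falsifies a (◇ φ)     φ∈ (b , h)       = falsifies b φ (hin a _ φ∈ b) h
        falsifies a ([ i ] φ) φ∈ h             = let b , a≈b , x = hin a _ φ∈ in falsifies b φ x (h b a≈b)
        falsifies a (⟨ i ⟩ φ) φ∈ (b , a≈b , h) = falsifies b φ (hin a _ φ∈ b a≈b) h

        -- Quantifiers range over finitely many worlds, and valuation and cells are decidable.
        bivalent : Bivalent model
        bivalent a (atom p)  = natom⊣? p a
        bivalent a (natom p) = ¬? (natom⊣? p a)
        bivalent a (φ ∧ ψ)   = bivalent a φ ×-dec bivalent a ψ
        bivalent a (φ ∨ ψ)   = bivalent a φ ⊎-dec bivalent a ψ
        bivalent a (□ φ)     = all? λ b → bivalent b φ
        bivalent a (◇ φ)     = any? λ b → bivalent b φ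
        bivalent a ([ i ] φ) = all? λ b → (type a ≈[ i ]? type b) →-dec bivalent b φ
        bivalent a (⟨ i ⟩ φ) = any? λ b → (type a ≈[ i ]? type b) ×-dec bivalent b φ

      -- Validity refutes every set with a type listing the formula.

      refuted : Valid n φ₀ → ∀ {t} → t ∈ σ → φ₀ ∈ lits S t → Refuted σ
      refuted valid t∈ φ₀∈ with independent | limitedChoice | all-hintikka
      ... | inj₁ q   | _        | _        = q
      ... | inj₂ _   | inj₁ q   | _        = q
      ... | inj₂ _   | inj₂ _   | inj₁ q   = q
      ... | inj₂ ind | inj₂ lim | inj₂ hin =
        contradiction (valid model bivalent a₀)
          (falsifies a₀ φ₀ (subst (λ t → φ₀ ∈ lits S t) (lookup-index t∈) φ₀∈))
        where
        a₀ = Any.index t∈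
        open CounterModel a₀ ind lim hin

    -- The downward induction, as recursion on the list `U` of types whose status relative to `σ`
    -- may still be open. A type leaves `U` once the call with that type added to `σ` has refuted
    -- the larger set; with `U` empty, `σ` is saturated.
    refute : Valid n φ₀ → ∀ U σ → (∀ t → (t ∈ σ ⊎ Refuted (t ∷ σ)) ⊎ t ∈ U) →
             ∀ {t} → t ∈ σ → φ₀ ∈ lits S t → Refuted σ
    refute valid [] σ h t∈ φ₀∈ =
      Saturated.refuted σ (λ t → Sum.[ id , (λ ()) ] (h t)) valid t∈ φ₀∈
    refute valid (u ∷ U) σ h t∈ φ₀∈ = refute valid U σ without t∈ φ₀∈
      where
      with-u : ∀ t → (t ∈ u ∷ σ ⊎ Refuted (t ∷ u ∷ σ)) ⊎ t ∈ U
      with-u t with h t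
      ... | inj₁ (inj₁ t∈σ)     = inj₁ (inj₁ (there t∈σ))
      -- A refutation survives enlarging the set: the label realizing `u` is forgotten.
      ... | inj₁ (inj₂ q)       = inj₁ (inj₂ λ { (t⊨ ∷ _ ∷ r) → q (t⊨ ∷ r) })
      ... | inj₂ (here t≡u)     = inj₁ (inj₁ (here t≡u))
      ... | inj₂ (there t∈U)    = inj₂ t∈U
      without : ∀ t → (t ∈ σ ⊎ Refuted (t ∷ σ)) ⊎ t ∈ U
      without t with h t
      ... | inj₁ p           = inj₁ p
      ... | inj₂ (there t∈U) = inj₂ t∈U
      ... | inj₂ (here refl) = inj₁ (inj₂ (refute valid U (t ∷ σ) with-u (there t∈) φ₀∈))

theorem3 : (m n : ℕ) → 1 ≤ m → (φ : Formula m) (x : Label) →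
    Valid n φ → Derivable n [] ((x ∶ φ) ∷ [])
theorem3 m n _ φ x valid = complete S λ t → by-cases t (lits-decide S t (here refl))
  where
  open Refutation {m} {n} φ
  by-cases : ∀ t → φ ∈ lits S t ⊎ neg φ ∈ lits S t →
             Derivable n [] (map (x ∶_) (lits S t) ++ (x ∶ φ) ∷ [])
  -- The induction starts at the singleton of the type that `x` realizes, with every type open.
  by-cases t (inj₁ φ∈) = refute valid (types (length S)) (t ∷ []) (λ t → inj₂ (∈-types t)) (here refl) φ∈
    ((x , λ ψ∈ → ∈-++⁺ˡ (∈-map⁺ (x ∶_) ψ∈)) ∷ [])
  by-cases t (inj₂ φ̄∈) = identity φ (∈-++⁺ʳ _ (here refl)) (∈-++⁺ˡ (∈-map⁺ (x ∶_) φ̄∈))
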